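{- Let $n$ be primover to base $2$. Then $2^n-1$ is primover to base $2$ if and only if $n$ is prime.
   Context: For an integer $a>1$ and an odd integer $n>1$ with $\gcd(a,n)=1$: $h_a(n)$ denotes the multiplicative order of $a$ modulo $n$. A cyclotomic coset of $a$ modulo $n$ is a set of the form $\{\, s a^j \bmod n : j\ge 0\,\}$ with $s\in\{1,\dots,n-1\}$; these cosets partition $\{1,\dots,n-1\}$, and $r_a(n)$ denotes the number of distinct cyclotomic cosets of $a$ modulo $n$. An odd composite number $n$ coprime to $a$ is called an overpseudoprime to base $a$ if $n=r_a(n)\,h_a(n)+1$. An integer $N>1$ is called primover to base $a$ if it is either prime or an overpseudoprime to base $a$. -}

module Defs where

open import Data.Fin.Base using (Fin)
open import Data.Fin.Properties using (injective⇒≤)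
open import Data.Nat.Base using (ℕ; _+_; _*_; _^_; _%_; _≤_; _<_; NonZero; NonTrivial)
open import Data.Nat.Coprimality using (Coprime)
open import Data.Nat.Divisibility using (_∤_)
open import Data.Nat.Primality using (Prime; Composite; composite⇒nonZero)
open import Data.Nat.Properties using (≤-antisym)
open import Data.Product.Base using (Σ-syntax; ∃-syntax; _×_; _,_; proj₁; proj₂)
open import Data.Sum.Base using (_⊎_)
open import Function.Base using (_∘_)
open import Function.Bundles using (Bijection)
open import Level using (0ℓ)
open import Relation.Binary.Bundles using (Setoid)
open import Relation.Binary.PropositionalEquality using (_≡_; setoid)
open import Relation.Unary using (Pred)
open import Relation.Unary.Relation.Binary.Equality using (≐-setoid)
import Relation.Binary.Construct.On as On

record IsOrder (a n : ℕ) .{{_ : NonZero n}} (h : ℕ) : Set where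
  field
    positive : 0 < h
    isPeriod : a ^ h % n ≡ 1 % n
    minimal  : ∀ k → 0 < k → a ^ k % n ≡ 1 % n → h ≤ k

Coset : (a n : ℕ) .{{_ : NonZero n}} → ℕ → Pred ℕ 0ℓ
Coset a n s x = ∃[ j ] x ≡ (s * a ^ j) % n

-- A coset is presented by a representative s ∈ {1,…,n-1}; two presentations
-- are identified when they denote the same set.
Cosets : (a n : ℕ) .{{_ : NonZero n}} → Setoid 0ℓ 0ℓ
Cosets a n = On.setoid {B = Σ[ s ∈ ℕ ] (0 < s × s < n)} (≐-setoid ℕ 0ℓ) (Coset a n ∘ proj₁)

IsCosetCount : (a n : ℕ) .{{_ : NonZero n}} → ℕ → Set
IsCosetCount a n r = Bijection (setoid (Fin r)) (Cosets a n)

-- h and r are the numbers h_a(n) and r_a(n); they are unique by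
-- IsOrder-unique and IsCosetCount-unique below.
record Overpseudoprime (a : ℕ) .{{_ : NonTrivial a}} (n : ℕ) : Set where
  field
    odd       : 2 ∤ n
    composite : Composite n
    coprime   : Coprime a n

  instance
    n≢0 : NonZero n
    n≢0 = composite⇒nonZero composite

  field
    h r          : ℕ
    isOrder      : IsOrder a n h
    isCosetCount : IsCosetCount a n r
    n≡rh+1       : n ≡ r * h + 1

-- N > 1 is implied by either alternative.
Primover : (a : ℕ) .{{_ : NonTrivial a}} → ℕ → Set
Primover a N = Prime N ⊎ Overpseudoprime a N

IsOrder-unique : ∀ {a n} .{{_ : NonZero n}} {h h′} → IsOrder a n h → IsOrder a n h′ → h ≡ h′
IsOrder-unique o o′ = ≤-antisym (O.minimal _ O′.positive O′.isPeriod) (O′.minimal _ O.positive O.isPeriod)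
  where
  module O  = IsOrder o
  module O′ = IsOrder o′

IsCosetCount-unique : ∀ {a n} .{{_ : NonZero n}} {r r′} → IsCosetCount a n r → IsCosetCount a n r′ → r ≡ r′
IsCosetCount-unique {a} {n} c c′ = ≤-antisym (≤-count c c′) (≤-count c′ c)
  where
  module C = Setoid (Cosets a n)

  ≤-count : ∀ {r r′} → IsCosetCount a n r → IsCosetCount a n r′ → r ≤ r′
  ≤-count {r} {r′} b b′ = injective⇒≤ {f = f} f-injective
    where
    module B  = Bijection b
    module B′ = Bijection b′

    f : Fin r → Fin r′
    f i = proj₁ (B′.strictlySurjective (B.to i))

    to∘f : ∀ i → B′.to (f i) C.≈ B.to i
    to∘f i = proj₂ (B′.strictlySurjective (B.to i))

    f-injective : ∀ {i j} → f i ≡ f j → i ≡ j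
    f-injective {i} {j} eq = B.injective (C.trans {B.to i} {B′.to (f i)} {B.to j} (C.sym {B′.to (f i)} {B.to i} (to∘f i))
      (C.trans {B′.to (f i)} {B′.to (f j)} {B.to j} (B′.cong eq) (to∘f j)))

{-# OPTIONS --safe #-}

-- Multiplication by a acts on the nonzero residues modulo n, and its orbits are
-- the cyclotomic cosets.  Every orbit has at most h_a(n) elements, so
-- n − 1 ≤ r_a(n) h_a(n), with equality exactly when no nonzero residue s has
-- s aᵏ ≡ s for some 0 < k < h_a(n), i.e. when the action is free.
-- Put M = 2ⁿ − 1, so that the order of 2 modulo M is n.  If n is prime and
-- s 2ᵏ ≡ s with 0 < k < n, then Bézout for k and n gives 2 s ≡ s, so s ≡ 0: the
-- action is free.  If n has a divisor 1 < d < n, then s = M / (2ᵈ − 1) satisfies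
-- s 2ᵈ = s + M, so the action is not free.
module Submission where

open import Defs
open import Data.Fin.Base using (Fin; zero; suc; toℕ; fromℕ<; combine; remQuot; punchOut)
open import Data.Fin.Properties using (any?; combine-injectiveʳ; combine-remQuot; injective⇒≤; punchOut-injective; remQuot-combine; toℕ<n; toℕ-fromℕ<; toℕ-injective)
import Data.Fin.Properties as Fin
open import Data.List.Base using (List; _∷_; deduplicate; length; lookup; tabulate)
open import Data.List.Membership.Setoid.Properties using (∈-lookup; ∈-resp-≈; ∈-tabulate⁺)
open import Data.List.Relation.Unary.AllPairs using (_∷_)
open import Data.List.Relation.Unary.Enumerates.Setoid.Properties using (deduplicate⁺; lookup-surjective)
open import Data.List.Relation.Unary.Unique.DecSetoid.Properties using (deduplicate-!)
import Data.List.Relation.Unary.Unique.Setoid as Unique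
open import Data.List.Relation.Unary.Unique.Setoid.Properties using (Unique[x∷xs]⇒x∉xs)
open import Data.Nat.Base using (ℕ; zero; suc; pred; _+_; _*_; _^_; _∸_; _/_; _%_; _≤_; _<_; z<s; s<s; NonZero; NonTrivial; >-nonZero; n>1⇒nonTrivial; nonTrivial⇒n>1)
open import Data.Nat.Coprimality using (Coprime; coprime-Bézout; prime⇒coprime)
open import Data.Nat.Divisibility using (_∣_; divides; hasNonTrivialDivisor; ∣-refl; ∣-trans; ∣m+n∣m⇒∣n; ∣1⇒≡1; m∣m*n)
open import Data.Nat.DivMod using (%-distribˡ-*; [m+n]%n≡m%n; m%n%n≡m%n; m%n<n; m<n⇒m%n≡m; m≡m%n+[m/n]*n)
open import Data.Nat.GCD using (module Bézout)
open import Data.Nat.Primality using (Prime; Composite; composite⇒¬prime; composite⇒nonTrivial; prime?; prime⇒nonTrivial; ¬prime⇒composite)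
open import Data.Nat.Properties
open import Data.Nat.Tactic.RingSolver using (solve-∀)
open import Data.Product.Base using (Σ-syntax; ∃-syntax; _×_; _,_; proj₁; proj₂)
open import Data.Sum.Base using (inj₁; inj₂)
open import Function.Base using (_∘_)
open import Function.Bundles using (Bijection; _⇔_; mk⇔)
open import Function.Definitions using (Injective)
open import Relation.Binary.Bundles using (DecSetoid; Setoid)
open import Relation.Binary.Definitions using (Decidable; tri<; tri≈; tri>)
open import Relation.Binary.PropositionalEquality using (_≡_; _≢_; refl; sym; trans; cong; cong₂; subst; setoid; module ≡-Reasoning)
open import Relation.Nullary.Decidable using (yes; no; map′)
open import Relation.Nullary.Negation using (¬_; contradiction)
open import Relation.Unary using (_⊆_)

-- Finite sets

-- A missed value could be punched out of the codomain, leaving an injection from `Fin m` into a set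
-- with fewer than `m` elements.
injective⇒surjective : ∀ {m k} {f : Fin m → Fin k} → k ≤ m →
                       Injective _≡_ _≡_ f → ∀ y → ∃[ x ] f x ≡ y
injective⇒surjective {m} {suc k} {f} k≤m f-inj y with any? (λ x → f x Fin.≟ y)
... | yes hit = hit
... | no miss = contradiction
  (injective⇒≤ {f = λ x → punchOut (y≢f x)} (f-inj ∘ punchOut-injective (y≢f _) (y≢f _)))
  (<⇒≱ k≤m)
  where
  y≢f : ∀ x → y ≢ f x
  y≢f x y≡fx = miss (x , sym y≡fx)

module _ {c ℓ} (S : Setoid c ℓ) where
  open Setoid S using (_≈_) renaming (sym to ≈-sym)

  unique⇒lookup-injective : ∀ {xs} → Unique.Unique S xs → Injective _≡_ _≈_ (lookup xs)
  unique⇒lookup-injective (_ ∷ _) {zero} {zero} _ = refl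
  unique⇒lookup-injective {_ ∷ xs} xs! {zero} {suc j} x≈y =
    contradiction (∈-resp-≈ S (≈-sym x≈y) (∈-lookup S xs j)) (Unique[x∷xs]⇒x∉xs S xs!)
  unique⇒lookup-injective {_ ∷ xs} xs! {suc i} {zero} y≈x =
    contradiction (∈-resp-≈ S y≈x (∈-lookup S xs i)) (Unique[x∷xs]⇒x∉xs S xs!)
  unique⇒lookup-injective (_ ∷ xs!) {suc i} {suc j} eq =
    cong suc (unique⇒lookup-injective xs! eq)

module _ {c ℓ} (DS : DecSetoid c ℓ) where
  open DecSetoid DS using (_≈_) renaming (Carrier to A; _≟_ to _≈?_; setoid to S; refl to ≈-refl)

  -- Deduplicating the values of `f` up to `_≈_` keeps one element per class, so the length of the
  -- remaining list counts the classes.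
  finite⇒bijection : ∀ {m} (f : Fin m → A) → (∀ x → ∃[ i ] f i ≈ x) →
                     ∃[ r ] Bijection (setoid (Fin r)) S
  finite⇒bijection f f-surj = length xs , record
    { to        = lookup xs
    ; cong      = λ { refl → ≈-refl }
    ; bijective = unique⇒lookup-injective S (deduplicate-! DS (tabulate f))
                , lookup-surjective S (deduplicate⁺ DS λ x →
                    ∈-resp-≈ S (proj₂ (f-surj x)) (∈-tabulate⁺ S (proj₁ (f-surj x))))
    }
    where
    xs : List A
    xs = deduplicate _≈?_ (tabulate f)

-- Nonzero residues

Residue : ℕ → Set
Residue n = Σ[ s ∈ ℕ ] (0 < s × s < n)

module _ {n : ℕ} .{{_ : NonZero n}} where

  residue : Fin (pred n) → Residue n
  residue i = suc (toℕ i) , z<s , subst (suc (toℕ i) <_) (suc-pred n) (s<s (toℕ<n i))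

  residue-surjective : ((s , _) : Residue n) → ∃[ i ] proj₁ (residue i) ≡ s
  residue-surjective (suc s , _ , s<n) = fromℕ< s<n-1 , cong suc (toℕ-fromℕ< s<n-1)
    where
    s<n-1 : s < pred n
    s<n-1 = pred-mono-≤ s<n

-- The action of powers of a on residues modulo n

module Action (a n : ℕ) .{{_ : NonZero n}} where

  -- `Coset a n s` is by definition the set of values of `act s`, that is, the orbit of `s`.
  act : ℕ → ℕ → ℕ
  act s j = (s * a ^ j) % n

  act<n : ∀ s j → act s j < n
  act<n s j = m%n<n (s * a ^ j) n

  act-0 : ∀ {s} → s < n → act s 0 ≡ s
  act-0 {s} s<n = trans (cong (_% n) (*-identityʳ s)) (m<n⇒m%n≡m s<n)

  act-+ : ∀ s i j → act s (i + j) ≡ act (act s i) j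
  act-+ s i j = begin
    (s * a ^ (i + j)) % n                  ≡⟨ cong (λ x → (s * x) % n) (^-distribˡ-+-* a i j) ⟩
    (s * (a ^ i * a ^ j)) % n              ≡⟨ cong (_% n) (*-assoc s (a ^ i) (a ^ j)) ⟨
    (s * a ^ i * a ^ j) % n                ≡⟨ %-distribˡ-* (s * a ^ i) (a ^ j) n ⟩
    -- `act s i` is already reduced; reducing it again gives the shape in which `%-distribˡ-*` can
    -- be read backwards.
    (act s i * (a ^ j % n)) % n            ≡⟨ cong (λ x → (x * (a ^ j % n)) % n) (m%n%n≡m%n (s * a ^ i) n) ⟨
    (act s i % n * (a ^ j % n)) % n        ≡⟨ %-distribˡ-* (act s i) (a ^ j) n ⟨
    act (act s i) j                        ∎
    where open ≡-Reasoning

  act-*-fixed : ∀ {s k} → s < n → act s k ≡ s → ∀ q → act s (q * k) ≡ s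
  act-*-fixed s<n fix zero = act-0 s<n
  act-*-fixed {s} {k} s<n fix (suc q) = begin
    act s (k + q * k)      ≡⟨ act-+ s k (q * k) ⟩
    act (act s k) (q * k)  ≡⟨ cong (λ x → act x (q * k)) fix ⟩
    act s (q * k)          ≡⟨ act-*-fixed s<n fix q ⟩
    s                      ∎
    where open ≡-Reasoning

  act-+-fixedʳ : ∀ {s k} j → act s k ≡ s → act s (j + k) ≡ act s j
  act-+-fixedʳ {s} {k} j fix = begin
    act s (j + k)      ≡⟨ cong (act s) (+-comm j k) ⟩
    act s (k + j)      ≡⟨ act-+ s k j ⟩
    act (act s k) j    ≡⟨ cong (λ x → act x j) fix ⟩
    act s j            ∎
    where open ≡-Reasoning

  -- Bézout gives a multiple of `k` and a multiple of `l` that differ by 1. Both fix `s`, hence so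
  -- does the exponent 1. Over the naturals either multiple may be the larger one, whence two cases.
  coprime-periods⇒act-1 : ∀ {s k l} → s < n → Coprime k l →
                          act s k ≡ s → act s l ≡ s → act s 1 ≡ s
  coprime-periods⇒act-1 {s} {k} {l} s<n k⊥l fixₖ fixₗ with coprime-Bézout k⊥l
  ... | Bézout.+- x y eq = begin
    act s 1            ≡⟨ act-+-fixedʳ {k = y * l} 1 (act-*-fixed {k = l} s<n fixₗ y) ⟨
    act s (1 + y * l)  ≡⟨ cong (act s) eq ⟩
    act s (x * k)      ≡⟨ act-*-fixed s<n fixₖ x ⟩
    s                  ∎
    where open ≡-Reasoning
  ... | Bézout.-+ x y eq = begin
    act s 1            ≡⟨ act-+-fixedʳ {k = x * k} 1 (act-*-fixed {k = k} s<n fixₖ x) ⟨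
    act s (1 + x * k)  ≡⟨ cong (act s) eq ⟩
    act s (y * l)      ≡⟨ act-*-fixed s<n fixₗ y ⟩
    s                  ∎
    where open ≡-Reasoning

  -- For `h` the order of `a`, this is freeness of the action of the cyclic group generated by `a`
  -- on the nonzero residues.
  Free : ℕ → Set
  Free h = ∀ {s k} → 0 < s → s < n → 0 < k → k < h → act s k ≢ s

  coset-⊆ : ∀ s t j → t ≡ act s j → Coset a n t ⊆ Coset a n s
  coset-⊆ s _ j t≡ (i , x≡) =
    j + i , trans x≡ (trans (cong (λ u → act u i) t≡) (sym (act-+ s j i)))

  representative∈coset : ∀ {s} → s < n → Coset a n s s
  representative∈coset s<n = 0 , sym (act-0 s<n)

-- Orbits under a base of known order

module Orbits (a n : ℕ) .{{_ : NonZero n}} {h : ℕ} (order : IsOrder a n h) where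
  open Action a n
  open IsOrder order

  private instance
    h≢0 : NonZero h
    h≢0 = >-nonZero positive

  act-h : ∀ {s} → s < n → act s h ≡ s
  act-h {s} s<n = begin
    (s * a ^ h) % n            ≡⟨ %-distribˡ-* s (a ^ h) n ⟩
    (s % n * (a ^ h % n)) % n  ≡⟨ cong (λ x → (s % n * x) % n) isPeriod ⟩
    (s % n * (1 % n)) % n      ≡⟨ %-distribˡ-* s 1 n ⟨
    (s * 1) % n                ≡⟨ act-0 s<n ⟩
    s                          ∎
    where open ≡-Reasoning

  act-% : ∀ {s} → s < n → ∀ j → act s j ≡ act s (j % h)
  act-% {s} s<n j = begin
    act s j                        ≡⟨ cong (act s) (m≡m%n+[m/n]*n j h) ⟩
    act s (j % h + j / h * h)      ≡⟨ act-+-fixedʳ (j % h) (act-*-fixed s<n (act-h s<n) (j / h)) ⟩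
    act s (j % h)                  ∎
    where open ≡-Reasoning

  -- Modulo `h` the exponent `i * pred h` is -i, so inverse powers of `a` can be written with
  -- natural exponents.
  i+i*[h-1]≡i*h : ∀ i → i + i * pred h ≡ i * h
  i+i*[h-1]≡i*h i = trans (sym (*-suc i (pred h))) (cong (i *_) (suc-pred h))

  act-inverse : ∀ {s} → s < n → ∀ j → act (act s j) (j * pred h) ≡ s
  act-inverse {s} s<n j = begin
    act (act s j) (j * pred h)  ≡⟨ act-+ s j (j * pred h) ⟨
    act s (j + j * pred h)      ≡⟨ cong (act s) (i+i*[h-1]≡i*h j) ⟩
    act s (j * h)               ≡⟨ act-*-fixed s<n (act-h s<n) j ⟩
    s                           ∎
    where open ≡-Reasoning

  act-cancelˡ : ∀ {s} → s < n → ∀ i d → act s (d + i) ≡ act s i → act s d ≡ s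
  act-cancelˡ {s} s<n i d eq = begin
    act s d                           ≡⟨ act-+-fixedʳ d (act-*-fixed s<n (act-h s<n) i) ⟨
    act s (d + i * h)                 ≡⟨ cong (λ x → act s (d + x)) (i+i*[h-1]≡i*h i) ⟨
    act s (d + (i + i * pred h))      ≡⟨ cong (act s) (+-assoc d i (i * pred h)) ⟨
    act s (d + i + i * pred h)        ≡⟨ act-+ s (d + i) (i * pred h) ⟩
    act (act s (d + i)) (i * pred h)  ≡⟨ cong (λ x → act x (i * pred h)) eq ⟩
    act (act s i) (i * pred h)        ≡⟨ act-inverse s<n i ⟩
    s                                 ∎
    where open ≡-Reasoning

  -- The inverse power brings `act s j` back to `s`, whereas it would keep 0 at 0.
  act>0 : ∀ {s} → 0 < s → s < n → ∀ j → 0 < act s j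
  act>0 {s} 0<s s<n j = n≢0⇒n>0 λ act≡0 → n>0⇒n≢0 0<s (begin
    s                           ≡⟨ act-inverse s<n j ⟨
    act (act s j) (j * pred h)  ≡⟨ cong (λ x → act x (j * pred h)) act≡0 ⟩
    0 % n                       ≡⟨ m<n⇒m%n≡m (<-trans 0<s s<n) ⟩
    0                           ∎)
    where open ≡-Reasoning

  -- If `i` and `j` differed, cancelling the smaller exponent would leave a positive exponent below
  -- `h` that fixes `s`.
  free⇒act-injective : Free h → ∀ {s i j} → 0 < s → s < n → i < h → j < h →
                       act s i ≡ act s j → i ≡ j
  free⇒act-injective free {s} {i} {j} 0<s s<n i<h j<h eq with <-cmp i j
  ... | tri≈ _ i≡j _ = i≡j
  ... | tri< i<j _ _ = contradiction
    (act-cancelˡ s<n i (j ∸ i) (trans (cong (act s) (m∸n+n≡m (<⇒≤ i<j))) (sym eq)))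
    (free 0<s s<n (m<n⇒0<n∸m i<j) (≤-<-trans (m∸n≤m j i) j<h))
  ... | tri> _ _ j<i = contradiction
    (act-cancelˡ s<n j (i ∸ j) (trans (cong (act s) (m∸n+n≡m (<⇒≤ j<i))) eq))
    (free 0<s s<n (m<n⇒0<n∸m j<i) (≤-<-trans (m∸n≤m i j) i<h))

  -- Equality and number of cyclotomic cosets

  open Setoid (Cosets a n) using (_≈_)

  -- The power leading from `s` to `t` can be undone, so each of the two cosets contains the other.
  ∈coset⇒≈ : ((s , s+) (t , t+) : Residue n) → Coset a n s t → (s , s+) ≈ (t , t+)
  ∈coset⇒≈ (s , _ , s<n) (t , _) (j , t≡) =
    coset-⊆ t s (j * pred h) (sym (trans (cong (λ x → act x (j * pred h)) t≡) (act-inverse s<n j)))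
    , coset-⊆ s t j t≡

  ≈⇒∈coset : ((s , s+) (t , t+) : Residue n) → (s , s+) ≈ (t , t+) → Coset a n s t
  ≈⇒∈coset _ (t , _ , t<n) s≈t = proj₂ s≈t (representative∈coset t<n)

  -- Equality of cosets amounts to membership of `t` in the orbit of `s`, and by periodicity a
  -- search through the exponents below `h` settles that.
  _≈?_ : Decidable _≈_
  x@(s , _ , s<n) ≈? y@(t , _) = map′
    (λ (j , _ , t≡) → ∈coset⇒≈ x y (j , t≡))
    (λ x≈y → let (j , t≡) = ≈⇒∈coset x y x≈y in j % h , m%n<n j h , trans t≡ (act-% s<n j))
    (anyUpTo? (λ j → t ≟ act s j) h)

  cosetCount : ∃[ r ] IsCosetCount a n r
  cosetCount = finite⇒bijection
    record { isDecEquivalence = record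
      { isEquivalence = Setoid.isEquivalence (Cosets a n) ; _≟_ = _≈?_ } }
    residue
    (λ x@(_ , _ , x<n) → let (i , eq) = residue-surjective x in
      i , ∈coset⇒≈ (residue i) x (0 , sym (trans (cong (λ s → act s 0) eq) (act-0 x<n))))

  -- Counting nonzero residues by coset and exponent

  module _ {r : ℕ} (count : IsCosetCount a n r) where
    private module B = Bijection count

    rep : Fin r → ℕ
    rep i = proj₁ (B.to i)

    rep>0 : ∀ i → 0 < rep i
    rep>0 i = proj₁ (proj₂ (B.to i))

    rep<n : ∀ i → rep i < n
    rep<n i = proj₂ (proj₂ (B.to i))

    -- Both directions are kept: the first enumerates residues from representatives, the second
    -- carries a fixed point from `s` to its representative.
    rep-∈coset : ((s , _) : Residue n) → ∃[ i ] Coset a n (rep i) s × Coset a n s (rep i)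
    rep-∈coset x = let (i , i≈x) = B.strictlySurjective x in
      i , ≈⇒∈coset (B.to i) x i≈x , proj₁ i≈x (representative∈coset (rep<n i))

    -- An r by h table with one row per coset and one column per exponent below `h`; freeness means
    -- that it has no repeated entry.
    element : Fin (r * h) → ℕ
    element z = let (i , j) = remQuot {r} h z in act (rep i) (toℕ j)

    element-combine : ∀ i j → element (combine i j) ≡ act (rep i) (toℕ j)
    element-combine i j = cong (λ (i , j) → act (rep i) (toℕ j)) (remQuot-combine {r} {h} i j)

    element-surjective : ((s , _) : Residue n) → ∃[ z ] element z ≡ s
    element-surjective x@(s , _) = let (i , (j , s≡) , _) = rep-∈coset x in
      combine i (fromℕ< (m%n<n j h)) , (begin
        element (combine i (fromℕ< (m%n<n j h)))    ≡⟨ element-combine i _ ⟩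
        act (rep i) (toℕ (fromℕ< (m%n<n j h)))      ≡⟨ cong (act (rep i)) (toℕ-fromℕ< (m%n<n j h)) ⟩
        act (rep i) (j % h)                         ≡⟨ act-% (rep<n i) j ⟨
        act (rep i) j                               ≡⟨ s≡ ⟨
        s                                           ∎)
      where open ≡-Reasoning

    -- A section of `element`; its injectivity is the inequality n - 1 ≤ r h.
    position : Fin (pred n) → Fin (r * h)
    position i = proj₁ (element-surjective (residue i))

    element-position : ∀ i → element (position i) ≡ suc (toℕ i)
    element-position i = proj₂ (element-surjective (residue i))

    position-injective : Injective _≡_ _≡_ position
    position-injective {i} {j} eq = toℕ-injective (suc-injective
      (trans (sym (element-position i)) (trans (cong element eq) (element-position j))))

    -- Under this bound `position` is also onto, so every table index is the chosen position of some
    -- residue, and `element` recovers that residue.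
    r*h≤n-1⇒element-injective : r * h ≤ pred n → Injective _≡_ _≡_ element
    r*h≤n-1⇒element-injective r*h≤n-1 {y} {z} eq
      with i , refl ← injective⇒surjective r*h≤n-1 position-injective y
         | j , refl ← injective⇒surjective r*h≤n-1 position-injective z
      = cong position (toℕ-injective (suc-injective
          (trans (sym (element-position i)) (trans eq (element-position j)))))

    -- An exponent `k` fixing `s` fixes its whole orbit, in particular the representative. Columns
    -- `k` and 0 of that row then agree, against injectivity of the table.
    n≡r*h+1⇒free : n ≡ r * h + 1 → Free h
    n≡r*h+1⇒free n≡ {s} {k} 0<s s<n 0<k k<h fix = contradiction k≡0 (n>0⇒n≢0 0<k)
      where
      open ≡-Reasoning
      i : Fin r
      i = proj₁ (rep-∈coset (s , 0<s , s<n))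
      m : ℕ
      m = proj₁ (proj₂ (proj₂ (rep-∈coset (s , 0<s , s<n))))
      rep≡ : rep i ≡ act s m
      rep≡ = proj₂ (proj₂ (proj₂ (rep-∈coset (s , 0<s , s<n))))

      rep-fixed : act (rep i) k ≡ rep i
      rep-fixed = begin
        act (rep i) k    ≡⟨ cong (λ x → act x k) rep≡ ⟩
        act (act s m) k  ≡⟨ act-+ s m k ⟨
        act s (m + k)    ≡⟨ act-+-fixedʳ m fix ⟩
        act s m          ≡⟨ rep≡ ⟨
        rep i            ∎

      r*h≤n-1 : r * h ≤ pred n
      r*h≤n-1 = ≤-reflexive (cong pred (sym (trans n≡ (+-comm (r * h) 1))))

      k′ 0′ : Fin h
      k′ = fromℕ< k<h
      0′ = fromℕ< positive

      same-element : element (combine i k′) ≡ element (combine i 0′)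
      same-element = begin
        element (combine i k′)  ≡⟨ element-combine i k′ ⟩
        act (rep i) (toℕ k′)    ≡⟨ cong (act (rep i)) (toℕ-fromℕ< k<h) ⟩
        act (rep i) k           ≡⟨ rep-fixed ⟩
        rep i                   ≡⟨ act-0 (rep<n i) ⟨
        act (rep i) 0           ≡⟨ cong (act (rep i)) (toℕ-fromℕ< positive) ⟨
        act (rep i) (toℕ 0′)    ≡⟨ element-combine i 0′ ⟨
        element (combine i 0′)  ∎

      k≡0 : k ≡ 0
      k≡0 = begin
        k       ≡⟨ toℕ-fromℕ< k<h ⟨
        toℕ k′  ≡⟨ cong toℕ (combine-injectiveʳ i k′ i 0′ (r*h≤n-1⇒element-injective r*h≤n-1 same-element)) ⟩
        toℕ 0′  ≡⟨ toℕ-fromℕ< positive ⟩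
        0       ∎

    -- The common value is a nonzero residue lying in both cosets, so they coincide, and distinct
    -- indices enumerate distinct cosets.
    act≡⇒same-rep : ∀ {i i′} j j′ → act (rep i) j ≡ act (rep i′) j′ → i ≡ i′
    act≡⇒same-rep {i} {i′} j j′ eq = B.injective
      (Setoid.trans (Cosets a n) {B.to i} {x} {B.to i′}
        (∈coset⇒≈ (B.to i) x (j , refl))
        (Setoid.sym (Cosets a n) {B.to i′} {x} (∈coset⇒≈ (B.to i′) x (j′ , eq))))
      where
      x : Residue n
      x = act (rep i) j , act>0 (rep>0 i) (rep<n i) j , act<n (rep i) j

    free⇒element-injective : Free h → Injective _≡_ _≡_ element
    free⇒element-injective free {y} {z} eq = begin
      y              ≡⟨ combine-remQuot {r} h y ⟨
      combine i j    ≡⟨ cong₂ combine i≡i′ (toℕ-injective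
                          (free⇒act-injective free (rep>0 i) (rep<n i) (toℕ<n j) (toℕ<n j′)
                            (trans eq (cong (λ i → act (rep i) (toℕ j′)) (sym i≡i′))))) ⟩
      combine i′ j′  ≡⟨ combine-remQuot {r} h z ⟩
      z              ∎
      where
      open ≡-Reasoning
      i i′ : Fin r
      i  = proj₁ (remQuot {r} h y)
      i′ = proj₁ (remQuot {r} h z)
      j j′ : Fin h
      j  = proj₂ (remQuot {r} h y)
      j′ = proj₂ (remQuot {r} h z)
      i≡i′ : i ≡ i′
      i≡i′ = act≡⇒same-rep (toℕ j) (toℕ j′) eq

    -- `position` injects the residues into the table, and under freeness `element` injects the
    -- table into the residues.
    free⇒n≡r*h+1 : Free h → n ≡ r * h + 1
    free⇒n≡r*h+1 free = begin
      n             ≡⟨ suc-pred n ⟨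
      suc (pred n)  ≡⟨ cong suc (≤-antisym (injective⇒≤ position-injective) (injective⇒≤ index-injective)) ⟩
      suc (r * h)   ≡⟨ +-comm 1 (r * h) ⟩
      r * h + 1     ∎
      where
      open ≡-Reasoning
      toResidue : Fin (r * h) → Residue n
      toResidue z = let (i , j) = remQuot {r} h z in
        element z , act>0 (rep>0 i) (rep<n i) (toℕ j) , act<n (rep i) (toℕ j)

      indexOf : Fin (r * h) → Fin (pred n)
      indexOf z = proj₁ (residue-surjective (toResidue z))

      index-injective : Injective _≡_ _≡_ indexOf
      index-injective {y} {z} eq = free⇒element-injective free (begin
        element y                      ≡⟨ proj₂ (residue-surjective (toResidue y)) ⟨
        proj₁ (residue {n} (indexOf y))  ≡⟨ cong (proj₁ ∘ residue {n}) eq ⟩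
        proj₁ (residue {n} (indexOf z))  ≡⟨ proj₂ (residue-surjective (toResidue z)) ⟩
        element z                      ∎)

-- Mersenne numbers

mersenne : ℕ → ℕ
mersenne n = 2 ^ n ∸ 1

1+mersenne : ∀ n → suc (mersenne n) ≡ 2 ^ n
1+mersenne n = m+[n∸m]≡n (m^n>0 2 n)

-- This makes such powers their own residues modulo `mersenne n`. Positivity of `k` gives 1 < 2ᵏ,
-- which makes the bound strict.
2^k<mersenne : ∀ {k n} → 0 < k → k < n → 2 ^ k < mersenne n
2^k<mersenne {k} {n} 0<k k<n = ≤-pred (begin-strict
  1 + 2 ^ k            <⟨ +-monoˡ-< (2 ^ k) (^-monoʳ-< 2 (n<1+n 1) 0<k) ⟩
  2 ^ k + 2 ^ k        ≡⟨ cong (2 ^ k +_) (+-identityʳ (2 ^ k)) ⟨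
  2 ^ suc k            ≤⟨ ^-monoʳ-≤ 2 k<n ⟩
  2 ^ n                ≡⟨ 1+mersenne n ⟨
  suc (mersenne n)     ∎)
  where open ≤-Reasoning

mersenne>1 : ∀ {n} → 1 < n → 1 < mersenne n
mersenne>1 1<n = <-trans (n<1+n 1) (2^k<mersenne z<s 1<n)

-- Since 2ⁿ = 1 + M, the exponent `n` is a period; smaller positive exponents give powers strictly
-- between 1 and M, which are not 1 modulo M.
mersenne-order : ∀ {n} .{{_ : NonZero (mersenne n)}} → 1 < n → IsOrder 2 (mersenne n) n
mersenne-order {n} 1<n = record
  { positive = <-trans z<s 1<n
  ; isPeriod = trans (cong (_% M) (sym (1+mersenne n))) ([m+n]%n≡m%n 1 M)
  ; minimal  = λ k 0<k fix → ≮⇒≥ λ k<n → >⇒≢ (^-monoʳ-< 2 (n<1+n 1) 0<k) (2^k≡1 0<k k<n fix)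
  }
  where
  M = mersenne n
  2^k≡1 : ∀ {k} → 0 < k → k < n → 2 ^ k % M ≡ 1 % M → 2 ^ k ≡ 1
  2^k≡1 {k} 0<k k<n fix = begin
    2 ^ k      ≡⟨ m<n⇒m%n≡m (2^k<mersenne 0<k k<n) ⟨
    2 ^ k % M  ≡⟨ fix ⟩
    1 % M      ≡⟨ m<n⇒m%n≡m (mersenne>1 1<n) ⟩
    1          ∎
    where open ≡-Reasoning

mersenne-coprime-2 : ∀ {n} → 0 < n → Coprime 2 (mersenne n)
mersenne-coprime-2 {suc m} _ {d} (d∣2 , d∣M) =
  ∣1⇒≡1 (∣m+n∣m⇒∣n (subst (d ∣_) 2^n≡M+1 (∣-trans d∣2 (m∣m*n (2 ^ m)))) d∣M)
  where
  2^n≡M+1 : 2 ^ suc m ≡ mersenne (suc m) + 1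
  2^n≡M+1 = trans (sym (1+mersenne (suc m))) (+-comm 1 _)

-- The base x of x − 1 ∣ xᵠ − 1 is written 1 + y to avoid truncated subtraction.
y∣[1+y]^q-1 : ∀ y q → ∃[ t ] suc y ^ q ≡ 1 + t * y
y∣[1+y]^q-1 y zero    = 0 , refl
y∣[1+y]^q-1 y (suc q) = let (t , eq) = y∣[1+y]^q-1 y q in
  t + 1 + t * y , trans (cong (suc y *_) eq) (expand y t)
  where
  expand : ∀ y t → suc y * (1 + t * y) ≡ 1 + (t + 1 + t * y) * y
  expand = solve-∀

-- For n = q d, write 2ⁿ as the q-th power of 2ᵈ = 1 + y with y = `mersenne d`.
mersenne-∣ : ∀ {d n} → d ∣ n → mersenne d ∣ mersenne n
mersenne-∣ {d} {n} (divides q n≡q*d) = let (t , eq) = y∣[1+y]^q-1 (mersenne d) q in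
  divides t (cong pred (begin
    2 ^ n                      ≡⟨ cong (2 ^_) (trans n≡q*d (*-comm q d)) ⟩
    2 ^ (d * q)                ≡⟨ ^-*-assoc 2 d q ⟨
    (2 ^ d) ^ q                ≡⟨ cong (_^ q) (1+mersenne d) ⟨
    suc (mersenne d) ^ q       ≡⟨ eq ⟩
    suc (t * mersenne d)       ∎))
  where open ≡-Reasoning

-- Division with remainder gives 2 s = s + q n, so s = q n, and s < n leaves only q = 0.
2s≡s⇒s≡0 : ∀ {s n} .{{_ : NonZero n}} → s < n → Action.act 2 n s 1 ≡ s → s ≡ 0
2s≡s⇒s≡0 {s} {n} s<n fix = small (s * 2 / n) (+-cancelˡ-≡ s _ _ (begin
  s + s                        ≡⟨ cong (s +_) (+-identityʳ s) ⟨
  2 * s                        ≡⟨ *-comm 2 s ⟩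
  s * 2                        ≡⟨ m≡m%n+[m/n]*n (s * 2) n ⟩
  s * 2 % n + s * 2 / n * n    ≡⟨ cong (_+ s * 2 / n * n) fix ⟩
  s + s * 2 / n * n            ∎))
  where
  open ≡-Reasoning
  small : ∀ q → s ≡ q * n → s ≡ 0
  small zero    s≡0     = s≡0
  small (suc q) s≡n+q*n = contradiction
    (≤-trans (m≤m+n n (q * n)) (≤-reflexive (sym s≡n+q*n))) (<⇒≱ s<n)

prime⇒mersenne-free : ∀ {p} .{{_ : NonZero (mersenne p)}} → Prime p → Action.Free 2 (mersenne p) p
prime⇒mersenne-free {p} p-prime {s} {k} 0<s s<M 0<k k<p fix = n>0⇒n≢0 0<s
  (2s≡s⇒s≡0 s<M (coprime-periods⇒act-1 s<M
    (prime⇒coprime p-prime {{>-nonZero 0<k}} k<p) (act-h s<M) fix))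
  where
  open Action 2 (mersenne p)
  open Orbits 2 (mersenne p) (mersenne-order (nonTrivial⇒n>1 p {{prime⇒nonTrivial p-prime}}))

composite⇒mersenne-composite : ∀ {n} → Composite n → Composite (mersenne n)
composite⇒mersenne-composite (hasNonTrivialDivisor {d} d<n d∣n) =
  hasNonTrivialDivisor {{n>1⇒nonTrivial (mersenne>1 1<d)}}
    (≤-<-trans (m∸n≤m (2 ^ d) 1) (2^k<mersenne (<-trans z<s 1<d) d<n))
    (mersenne-∣ d∣n)
  where
  1<d : 1 < d
  1<d = nonTrivial⇒n>1 d

composite⇒¬mersenne-free : ∀ {n} .{{_ : NonZero (mersenne n)}} →
                           Composite n → ¬ Action.Free 2 (mersenne n) n
composite⇒¬mersenne-free {n} (hasNonTrivialDivisor {d} d<n d∣n) free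
  with mersenne-∣ d∣n
-- The fixed residue is the cofactor `t`, with t 2ᵈ = t + t (2ᵈ - 1) = t + M.
... | divides t M≡t*m = free 0<t t<M (<-trans z<s 1<d) d<n (begin
    (t * 2 ^ d) % M             ≡⟨ cong (λ x → (t * x) % M) (1+mersenne d) ⟨
    (t * suc (mersenne d)) % M  ≡⟨ cong (_% M) (*-suc t (mersenne d)) ⟩
    (t + t * mersenne d) % M    ≡⟨ cong (λ x → (t + x) % M) M≡t*m ⟨
    (t + M) % M                 ≡⟨ [m+n]%n≡m%n t M ⟩
    t % M                       ≡⟨ m<n⇒m%n≡m t<M ⟩
    t                           ∎)
  where
  open ≡-Reasoning
  M : ℕ
  M = mersenne n

  1<d : 1 < d
  1<d = nonTrivial⇒n>1 d

  0<t : 0 < t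
  0<t = n≢0⇒n>0 λ t≡0 →
    n>0⇒n≢0 (<-trans z<s (mersenne>1 (<-trans 1<d d<n))) (trans M≡t*m (cong (_* mersenne d) t≡0))

  t<M : t < M
  t<M = subst (t <_) (sym M≡t*m)
    (m<m*n t (mersenne d) {{>-nonZero 0<t}} (mersenne>1 1<d))

-- Primover Mersenne numbers

overpseudoprime⇒free : ∀ {a n} .{{_ : NonTrivial a}} .{{_ : NonZero n}} {h} →
                       Overpseudoprime a n → IsOrder a n h → Action.Free a n h
overpseudoprime⇒free {a} {n} ψ order =
  Orbits.n≡r*h+1⇒free a n order isCosetCount
    (trans n≡rh+1 (cong (λ h → r * h + 1) (IsOrder-unique {{n≢0}} isOrder order)))
  where open Overpseudoprime ψ

-- A proper divisor of `n` yields both a proper divisor of M, excluding primality, and a residue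
-- with a short orbit, excluding the overpseudoprime equation.
composite⇒¬mersenne-primover : ∀ {n} → Composite n → ¬ Primover 2 (mersenne n)
composite⇒¬mersenne-primover n-composite (inj₁ M-prime) =
  composite⇒¬prime (composite⇒mersenne-composite n-composite) M-prime
composite⇒¬mersenne-primover {n} n-composite (inj₂ ψ) =
  composite⇒¬mersenne-free n-composite
    (overpseudoprime⇒free ψ (mersenne-order (nonTrivial⇒n>1 n {{composite⇒nonTrivial n-composite}})))
  where open Overpseudoprime ψ using (n≢0)

prime⇒mersenne-primover : ∀ {p} → Prime p → Primover 2 (mersenne p)
prime⇒mersenne-primover {p} p-prime with prime? (mersenne p)
... | yes M-prime = inj₁ M-prime
... | no ¬M-prime = inj₂ record
  -- If 2 divided M, it would be a common divisor of 2 and M, and coprimality would give 2 = 1.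
  { odd          = λ 2∣M → contradiction (2⊥M (∣-refl , 2∣M)) λ ()
  ; composite    = ¬prime⇒composite {{n>1⇒nonTrivial (mersenne>1 1<p)}} ¬M-prime
  ; coprime      = 2⊥M
  ; h            = p
  ; r            = proj₁ cosetCount
  ; isOrder      = order
  ; isCosetCount = proj₂ cosetCount
  ; n≡rh+1       = free⇒n≡r*h+1 (proj₂ cosetCount) (prime⇒mersenne-free p-prime)
  }
  where
  1<p : 1 < p
  1<p = nonTrivial⇒n>1 p {{prime⇒nonTrivial p-prime}}

  2⊥M : Coprime 2 (mersenne p)
  2⊥M = mersenne-coprime-2 (<-trans z<s 1<p)

  instance
    M≢0 : NonZero (mersenne p)
    M≢0 = >-nonZero (<-trans z<s (mersenne>1 1<p))

  order : IsOrder 2 (mersenne p) p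
  order = mersenne-order 1<p

  open Orbits 2 (mersenne p) order

theorem3 : (n : ℕ) → Primover 2 n → (Primover 2 (2 ^ n ∸ 1) ⇔ Prime n)
theorem3 n (inj₁ n-prime) = mk⇔ (λ _ → n-prime) prime⇒mersenne-primover
-- An overpseudoprime `n` is composite, so the left-hand side is false and the forward direction is
-- vacuous.
theorem3 n (inj₂ ψ) = mk⇔
  (λ M-primover → contradiction M-primover (composite⇒¬mersenne-primover (Overpseudoprime.composite ψ)))
  prime⇒mersenne-primover
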